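{- $\mathsf{KFU}\vdash\forall a,b\,[\mathrm C(a)\wedge\mathrm C(b)\to\mathrm C(\oplus(a,b))\wedge\mathrm C(\mathsf{acc}(a,b))]$.
   Context: $\mathsf{TON}$ is the total applicative theory in $\mathcal L$ (constants $\mathsf{k},\mathsf{s},\mathsf{p},\mathsf{p}_0,\mathsf{p}_1,\mathsf{0},\mathsf{s}_\mathsf{N},\mathsf{p}_\mathsf{N},\mathsf{d}_\mathsf{N}$, application, predicate $\mathrm N$; $(x,y):=\mathsf pxy$, $(x)_i:=\mathsf p_ix$) with combinator, pairing, number and numerical-cases axioms, induction on $\mathrm N$, $\lambda$-abstraction and a fixed point combinator. $\mathcal L_{FS}$ adds constants $\dot=,\dot\neg,\dot\wedge,\dot\to,\dot\forall,\dot{\mathsf N},\mathsf l$ and predicates $\mathrm T,\mathrm U$; $\mathrm P(x):=\mathrm T(x)\vee\mathrm T(\dot\neg x)$, $\mathrm C(f):=\forall x\,\mathrm P(fx)$, $f\sqsubset g:=\forall x(\mathrm T(fx)\to\mathrm T(g(fx)))\wedge\forall x(\mathrm T(\dot\neg(fx))\to\mathrm T(g(\dot\neg(fx))))$. $\mathsf{KFU}$: $\mathsf{TON}$ (induction for all $\mathcal L_{FS}$-formulas) plus, for $\mathrm U(u)$: $\mathrm T(u(x\dot=y))\leftrightarrow x=y$; $\mathrm T(u(\dot\neg(x\dot=y)))\leftrightarrow x\ne y$; $\mathrm T(u(\dot{\mathsf N}x))\leftrightarrow\mathrm N(x)$; $\mathrm T(u(\dot\neg(\dot{\mathsf N}x)))\leftrightarrow\neg\mathrm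 N(x)$; $\mathrm T(u(\dot\neg(\dot\neg x)))\leftrightarrow\mathrm T(ux)$; $\mathrm T(u(x\dot\wedge y))\leftrightarrow\mathrm T(ux)\wedge\mathrm T(uy)$; $\mathrm T(u(\dot\neg(x\dot\wedge y)))\leftrightarrow\mathrm T(u(\dot\neg x))\vee\mathrm T(u(\dot\neg y))$; $\mathrm T(u(x\dot\to y))\leftrightarrow\mathrm T(u(\dot\neg x))\vee\mathrm T(uy)$; $\mathrm T(u(\dot\neg(x\dot\to y)))\leftrightarrow\mathrm T(ux)\wedge\mathrm T(u(\dot\neg y))$; $\mathrm T(u(\dot\forall f))\leftrightarrow\forall x\,\mathrm T(u(fx))$; $\mathrm T(u(\dot\neg(\dot\forall f)))\leftrightarrow\exists x\,\mathrm T(u(\dot\neg(fx)))$; $\neg(\mathrm T(ux)\wedge\mathrm T(u(\dot\neg x)))$; $\mathrm C(u)$; $\mathrm T(ux)\to\mathrm T(x)$; and $\mathrm C(f)\to\mathrm U(\mathsf lf)\wedge f\sqsubset\mathsf lf$. Terms: $x\dot\vee y:=\dot\neg(\dot\neg x\dot\wedge\dot\neg y)$; $\oplus(u,v):=\lambda z.[((z)_0\dot=\mathsf 0\,\dot\wedge\,u((z)_1))\dot\vee(\dot\neg((z)_0\dot=\mathsf 0)\,\dot\wedge\,v((z)_1))]$; $t$ is a term with $t(u,v,w)=\dot\forall(\lambda y.\,\oplus(u,v)(\mathsf 0,y)\dot\to[\oplus(u,v)(\mathsf 1,(y,w))\dot\to t(u,v,y)])$ ($\mathsf 1:=\mathsf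 s_\mathsf N\mathsf 0$); $\mathsf{acc}$ is a term with $\mathsf{acc}(u,v)x=\oplus(u,v)(\mathsf 0,x)\,\dot\wedge\,\dot\forall(\lambda y.\,\oplus(u,v)(\mathsf 0,y)\dot\to[\oplus(u,v)(\mathsf 1,(y,x))\dot\to\mathsf l(\oplus(u,v))(t(u,v,y))])$ (such terms exist by the recursion theorem of $\mathsf{TON}$). -}

module Defs where

open import Data.Product using (_×_; ∃)
open import Data.Sum using (_⊎_)
open import Relation.Nullary using (¬_; Dec)
open import Relation.Binary.PropositionalEquality using (_≡_; _≢_)

_⇔_ : Set → Set → Set
A ⇔ B = (A → B) × (B → A)

record L-Structure : Set₁ where
  infixl 30 _·_
  field
    D   : Set
    _·_ : D → D → D
    k s p p₀ p₁ 𝟘 sN pN dN : D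
    eqc negc andc impc allc natc l : D
    N T U : D → Set
    -- classical metatheory (models are classical structures)
    lem : (A : Set) → Dec A

module Notation (S : L-Structure) where
  infix 25 _≐_
  infixr 22 _∧̇_
  infixr 21 _∨̇_
  infixr 20 _→̇_
  open L-Structure S public
  ⟨_,_⟩ : D → D → D
  ⟨ x , y ⟩ = p · x · y
  π₀ π₁ : D → D
  π₀ x = p₀ · x
  π₁ x = p₁ · x
  𝟙 : D
  𝟙 = sN · 𝟘
  _≐_ : D → D → D
  x ≐ y = eqc · x · y
  ¬̇ : D → D
  ¬̇ x = negc · x
  _∧̇_ : D → D → D
  x ∧̇ y = andc · x · y
  _→̇_ : D → D → D
  x →̇ y = impc · x · y
  ∀̇ : D → D
  ∀̇ f = allc · f
  Ṅ : D → D
  Ṅ x = natc · x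
  _∨̇_ : D → D → D
  x ∨̇ y = ¬̇ (¬̇ x ∧̇ ¬̇ y)

  Pr : D → Set
  Pr x = T x ⊎ T (¬̇ x)
  C : D → Set
  C f = ∀ x → Pr (f · x)
  _⊏_ : D → D → Set
  f ⊏ g = (∀ x → T (f · x) → T (g · (f · x)))
        × (∀ x → T (¬̇ (f · x)) → T (g · ¬̇ (f · x)))

record IsKFU (S : L-Structure) : Set₁ where
  open Notation S
  field
    ax-k : ∀ x y → k · x · y ≡ x
    ax-s : ∀ x y z → s · x · y · z ≡ (x · z) · (y · z)
    ax-p₀ : ∀ x y → p₀ · ⟨ x , y ⟩ ≡ x
    ax-p₁ : ∀ x y → p₁ · ⟨ x , y ⟩ ≡ y
    ax-N0   : N 𝟘
    ax-NsN  : ∀ x → N x → N (sN · x)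
    ax-sN≢0 : ∀ x → N x → sN · x ≢ 𝟘
    ax-pNsN : ∀ x → N x → pN · (sN · x) ≡ x
    ax-pN   : ∀ x → N x → x ≢ 𝟘 → N (pN · x) × (sN · (pN · x) ≡ x)
    ax-dN= : ∀ x y a b → N a → N b → a ≡ b → dN · x · y · a · b ≡ x
    ax-dN≢ : ∀ x y a b → N a → N b → a ≢ b → dN · x · y · a · b ≡ y
    -- induction on N (rendered for all predicates on the carrier)
    ax-ind : (P : D → Set) → P 𝟘 → (∀ x → N x → P x → P (sN · x))
           → ∀ x → N x → P x
    U-eq    : ∀ u x y → U u → T (u · (x ≐ y)) ⇔ (x ≡ y)
    U-neq   : ∀ u x y → U u → T (u · ¬̇ (x ≐ y)) ⇔ (x ≢ y)
    U-N     : ∀ u x → U u → T (u · Ṅ x) ⇔ N x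
    U-nN    : ∀ u x → U u → T (u · ¬̇ (Ṅ x)) ⇔ (¬ N x)
    U-nn    : ∀ u x → U u → T (u · ¬̇ (¬̇ x)) ⇔ T (u · x)
    U-and   : ∀ u x y → U u → T (u · (x ∧̇ y)) ⇔ (T (u · x) × T (u · y))
    U-nand  : ∀ u x y → U u → T (u · ¬̇ (x ∧̇ y)) ⇔ (T (u · ¬̇ x) ⊎ T (u · ¬̇ y))
    U-imp   : ∀ u x y → U u → T (u · (x →̇ y)) ⇔ (T (u · ¬̇ x) ⊎ T (u · y))
    U-nimp  : ∀ u x y → U u → T (u · ¬̇ (x →̇ y)) ⇔ (T (u · x) × T (u · ¬̇ y))
    U-all   : ∀ u f → U u → T (u · ∀̇ f) ⇔ (∀ x → T (u · (f · x)))
    U-nall  : ∀ u f → U u → T (u · ¬̇ (∀̇ f)) ⇔ ∃ (λ x → T (u · ¬̇ (f · x)))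
    U-cons  : ∀ u x → U u → ¬ (T (u · x) × T (u · ¬̇ x))
    U-C     : ∀ u → U u → C u
    U-T     : ∀ u x → U u → T (u · x) → T x
    ax-l    : ∀ f → C f → U (l · f) × (f ⊏ (l · f))

-- The terms ⊕, t, acc of the paper, given by their defining equations in
-- a model.  λ-abstractions λz.e are represented by an element g with
-- g · z ≡ e (the β-law of λ-abstraction in TON).
record KFUTerms (S : L-Structure) : Set where
  open Notation S
  field
    ⊕   : D → D → D
    ⊕-β : ∀ u v z → ⊕ u v · z
            ≡ (((π₀ z ≐ 𝟘) ∧̇ (u · π₁ z)) ∨̇ (¬̇ (π₀ z ≐ 𝟘) ∧̇ (v · π₁ z)))
    t     : D → D → D → D
    tbody : D → D → D → D
    t-eq  : ∀ u v w → t u v w ≡ ∀̇ (tbody u v w)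
    tbody-β : ∀ u v w y → tbody u v w · y
            ≡ (⊕ u v · ⟨ 𝟘 , y ⟩ →̇ (⊕ u v · ⟨ 𝟙 , ⟨ y , w ⟩ ⟩ →̇ t u v y))
    acc     : D → D → D
    accbody : D → D → D → D
    acc-β   : ∀ u v x → acc u v · x ≡ (⊕ u v · ⟨ 𝟘 , x ⟩ ∧̇ ∀̇ (accbody u v x))
    accbody-β : ∀ u v x y → accbody u v x · y
            ≡ (⊕ u v · ⟨ 𝟘 , y ⟩
                →̇ (⊕ u v · ⟨ 𝟙 , ⟨ y , x ⟩ ⟩ →̇ (l · ⊕ u v · t u v y)))

{-# OPTIONS --safe #-}
-- Call a formula φ decided by u if T(u φ) or T(u (¬̇ φ)). For a truth
-- predicate u (U u) the decided formulas are closed under the connectives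
-- (under ∀̇ by excluded middle), and anything decided by u is in P, since
-- T(u x) → T(x). The element l f decides every f x when C(f) holds. So
-- ⊕(a,b)z is decided by l a when (z)₀ = 0 and by l b otherwise. For acc(a,b),
-- put g = ⊕(a,b). Then u = l(⊕(g, l g)) decides both g w and (l g) w for all
-- w, so u decides every formula acc(a,b)x.
module Submission where

open import Defs
open import Data.Product using (_×_; _,_; proj₁; proj₂; ∃)
open import Data.Sum using (_⊎_; inj₁; inj₂)
open import Data.Empty using (⊥-elim)
open import Relation.Nullary using (yes; no)
open import Relation.Binary.PropositionalEquality using (_≡_; _≢_; subst; sym)

module _ (S : L-Structure) (K : IsKFU S) where
  open Notation S
  open IsKFU K

  Decides : D → D → Set
  Decides u φ = T (u · φ) ⊎ T (u · ¬̇ φ)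

  module Decidability {u : D} (Uu : U u) where

    decides⇒Pr : ∀ {φ} → Decides u φ → Pr φ
    decides⇒Pr (inj₁ p) = inj₁ (U-T u _ Uu p)
    decides⇒Pr (inj₂ p) = inj₂ (U-T u _ Uu p)

    decides-≐ : ∀ x y → Decides u (x ≐ y)
    decides-≐ x y with lem (x ≡ y)
    ... | yes x≡y = inj₁ (proj₂ (U-eq u x y Uu) x≡y)
    ... | no x≢y  = inj₂ (proj₂ (U-neq u x y Uu) x≢y)

    ¬̇¬̇-intro : ∀ {x} → T (u · x) → T (u · ¬̇ (¬̇ x))
    ¬̇¬̇-intro {x} = proj₂ (U-nn u x Uu)

    refutes-∧̇ˡ : ∀ {x y} → T (u · ¬̇ x) → T (u · ¬̇ (x ∧̇ y))
    refutes-∧̇ˡ {x} {y} p = proj₂ (U-nand u x y Uu) (inj₁ p)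

    decides-¬̇ : ∀ {x} → Decides u x → Decides u (¬̇ x)
    decides-¬̇ (inj₁ p) = inj₂ (¬̇¬̇-intro p)
    decides-¬̇ (inj₂ p) = inj₁ p

    decides-¬̇⁻ : ∀ {x} → Decides u (¬̇ x) → Decides u x
    decides-¬̇⁻     (inj₁ p) = inj₂ p
    decides-¬̇⁻ {x} (inj₂ p) = inj₁ (proj₁ (U-nn u x Uu) p)

    decides-∧̇ : ∀ {x y} → Decides u x → (T (u · x) → Decides u y) →
                Decides u (x ∧̇ y)
    decides-∧̇ (inj₂ p) _ = inj₂ (refutes-∧̇ˡ p)
    decides-∧̇ {x} {y} (inj₁ p) dy with dy p
    ... | inj₁ q = inj₁ (proj₂ (U-and u x y Uu) (p , q))
    ... | inj₂ q = inj₂ (proj₂ (U-nand u x y Uu) (inj₂ q))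

    decides-∨̇ : ∀ {x y} → Decides u x → Decides u y → Decides u (x ∨̇ y)
    decides-∨̇ dx dy = decides-¬̇ (decides-∧̇ (decides-¬̇ dx) (λ _ → decides-¬̇ dy))

    decides-→̇ : ∀ {x y} → Decides u x → Decides u y → Decides u (x →̇ y)
    decides-→̇ {x} {y} (inj₂ p) _ = inj₁ (proj₂ (U-imp u x y Uu) (inj₁ p))
    decides-→̇ {x} {y} _ (inj₁ q) = inj₁ (proj₂ (U-imp u x y Uu) (inj₂ q))
    decides-→̇ {x} {y} (inj₁ p) (inj₂ q) = inj₂ (proj₂ (U-nimp u x y Uu) (p , q))

    decides-∀̇ : ∀ {f} → (∀ x → Decides u (f · x)) → Decides u (∀̇ f)
    decides-∀̇ {f} df with lem (∃ λ x → T (u · ¬̇ (f · x)))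
    ... | yes counterexample = inj₂ (proj₂ (U-nall u f Uu) counterexample)
    ... | no no-counterexample = inj₁ (proj₂ (U-all u f Uu) all-true)
      where
      all-true : ∀ x → T (u · (f · x))
      all-true x with df x
      ... | inj₁ p = p
      ... | inj₂ q = ⊥-elim (no-counterexample (x , q))

    decides-∧̇-elimʳ : ∀ {x y} → Decides u (x ∧̇ y) → T (u · x) → Decides u y
    decides-∧̇-elimʳ {x} {y} (inj₁ p) _ = inj₁ (proj₂ (proj₁ (U-and u x y Uu) p))
    decides-∧̇-elimʳ {x} {y} (inj₂ p) tx with proj₁ (U-nand u x y Uu) p
    ... | inj₁ t¬x = ⊥-elim (U-cons u x Uu (tx , t¬x))
    ... | inj₂ t¬y = inj₂ t¬y

    decides-∧̇-elimˡ : ∀ {x y} → Decides u (x ∧̇ y) → T (u · y) → Decides u x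
    decides-∧̇-elimˡ {x} {y} (inj₁ p) _ = inj₁ (proj₁ (proj₁ (U-and u x y Uu) p))
    decides-∧̇-elimˡ {x} {y} (inj₂ p) ty with proj₁ (U-nand u x y Uu) p
    ... | inj₁ t¬x = inj₂ t¬x
    ... | inj₂ t¬y = ⊥-elim (U-cons u y Uu (ty , t¬y))

    decides-∨̇-elimʳ : ∀ {x y} → Decides u (x ∨̇ y) → T (u · ¬̇ x) → Decides u y
    decides-∨̇-elimʳ d t¬x = decides-¬̇⁻ (decides-∧̇-elimʳ (decides-¬̇⁻ d) t¬x)

    decides-∨̇-elimˡ : ∀ {x y} → Decides u (x ∨̇ y) → T (u · ¬̇ y) → Decides u x
    decides-∨̇-elimˡ d t¬y = decides-¬̇⁻ (decides-∧̇-elimˡ (decides-¬̇⁻ d) t¬y)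

  l-decides : ∀ {f} → C f → ∀ x → Decides (l · f) (f · x)
  l-decides {f} Cf x with Cf x
  ... | inj₁ p = inj₁ (proj₁ (proj₂ (ax-l f Cf)) x p)
  ... | inj₂ p = inj₂ (proj₂ (proj₂ (ax-l f Cf)) x p)

  C-l : ∀ {f} → C f → C (l · f)
  C-l {f} Cf = U-C (l · f) (proj₁ (ax-l f Cf))

  𝟙≢𝟘 : 𝟙 ≢ 𝟘
  𝟙≢𝟘 = ax-sN≢0 𝟘 ax-N0

  module _ (τ : KFUTerms S) where
    open KFUTerms τ

    C-⊕ : ∀ {a b} → C a → C b → C (⊕ a b)
    C-⊕ {a} {b} Ca Cb z with lem (π₀ z ≡ 𝟘)
    ... | yes z₀≡𝟘 = subst Pr (sym (⊕-β a b z)) (decides⇒Pr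
          (decides-∨̇ (decides-∧̇ (decides-≐ _ _) (λ _ → l-decides Ca (π₁ z)))
                     (decides-∧̇ (decides-¬̇ (decides-≐ _ _))
                                (λ t≢ → ⊥-elim (proj₁ (U-neq _ _ _ Ula) t≢ z₀≡𝟘)))))
      where
      Ula : U (l · a)
      Ula = proj₁ (ax-l a Ca)
      open Decidability Ula
    ... | no z₀≢𝟘 = subst Pr (sym (⊕-β a b z)) (decides⇒Pr
          (decides-∨̇ (decides-∧̇ (decides-≐ _ _)
                                (λ t≡ → ⊥-elim (z₀≢𝟘 (proj₁ (U-eq _ _ _ Ulb) t≡))))
                     (decides-∧̇ (decides-¬̇ (decides-≐ _ _)) (λ _ → l-decides Cb (π₁ z)))))
      where
      Ulb : U (l · b)
      Ulb = proj₁ (ax-l b Cb)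
      open Decidability Ulb

    module Joint {f g : D} (Cf : C f) (Cg : C g) where

      Ul⊕ : U (l · ⊕ f g)
      Ul⊕ = proj₁ (ax-l (⊕ f g) (C-⊕ Cf Cg))

      open Decidability Ul⊕

      decides-⊕-β : ∀ n w → Decides (l · ⊕ f g)
        (((π₀ ⟨ n , w ⟩ ≐ 𝟘) ∧̇ (f · w)) ∨̇ (¬̇ (π₀ ⟨ n , w ⟩ ≐ 𝟘) ∧̇ (g · w)))
      decides-⊕-β n w =
        subst (λ w′ → Decides (l · ⊕ f g)
                        (((π₀ ⟨ n , w ⟩ ≐ 𝟘) ∧̇ (f · w′)) ∨̇ (¬̇ (π₀ ⟨ n , w ⟩ ≐ 𝟘) ∧̇ (g · w′))))
              (ax-p₁ n w)
              (subst (Decides (l · ⊕ f g)) (⊕-β f g ⟨ n , w ⟩) (l-decides (C-⊕ Cf Cg) ⟨ n , w ⟩))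

      decidesˡ : ∀ w → Decides (l · ⊕ f g) (f · w)
      decidesˡ w = decides-∧̇-elimʳ
        (decides-∨̇-elimˡ (decides-⊕-β 𝟘 w)
          (refutes-∧̇ˡ (¬̇¬̇-intro t≡)))
        t≡
        where
        t≡ : T (l · ⊕ f g · (π₀ ⟨ 𝟘 , w ⟩ ≐ 𝟘))
        t≡ = proj₂ (U-eq _ _ _ Ul⊕) (ax-p₀ 𝟘 w)

      decidesʳ : ∀ w → Decides (l · ⊕ f g) (g · w)
      decidesʳ w = decides-∧̇-elimʳ
        (decides-∨̇-elimʳ (decides-⊕-β 𝟙 w) (refutes-∧̇ˡ t≢))
        t≢
        where
        t≢ : T (l · ⊕ f g · ¬̇ (π₀ ⟨ 𝟙 , w ⟩ ≐ 𝟘))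
        t≢ = proj₂ (U-neq _ _ _ Ul⊕) (subst (_≢ 𝟘) (sym (ax-p₀ 𝟙 w)) 𝟙≢𝟘)

    C-acc : ∀ {a b} → C a → C b → C (acc a b)
    C-acc {a} {b} Ca Cb x = subst Pr (sym (acc-β a b x)) (decides⇒Pr
      (decides-∧̇ (decidesˡ _) (λ _ → decides-∀̇ λ y →
        subst (Decides _) (sym (accbody-β a b x y))
          (decides-→̇ (decidesˡ _) (decides-→̇ (decidesˡ _) (decidesʳ _))))))
      where
      C⊕ : C (⊕ a b)
      C⊕ = C-⊕ Ca Cb
      open Joint C⊕ (C-l C⊕)
      open Decidability Ul⊕

lemma4p5 : (S : L-Structure) → IsKFU S → (τ : KFUTerms S) →
    let open Notation S
        open KFUTerms τ
    in ∀ a b → C a → C b → C (⊕ a b) × C (acc a b)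
lemma4p5 S K τ a b Ca Cb = C-⊕ S K τ Ca Cb , C-acc S K τ Ca Cb
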